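{- Let $V$ be a finite set of truth values containing distinct elements $1,0$, and let $\models$ be an intersective mixed consequence truth-relation with minimal representation $\models_{\mathcal{D}_p^1,\mathcal{D}_c^1}\cap\dots\cap\models_{\mathcal{D}_p^K,\mathcal{D}_c^K}$. Let $f:V^n\to V$ and let $\mathcal{B}^p,\mathcal{B}^c\subseteq\mathcal{P}(\{1,\dots,n\})\times\mathcal{P}(\{1,\dots,n\})$. Then $f$ satisfies the regularity rule $(\mathcal{B}^p,\mathcal{B}^c)$ at the level of truth values, i.e. for all $\gamma,\delta\subseteq V$ and $x_1,\dots,x_n\in V$: $\gamma\cup\{f(x_1,\dots,x_n)\}\models\delta$ iff for all $(B_p,B_c)\in\mathcal{B}^p$: $\gamma\cup\{x_i:i\in B_p\}\models\{x_i:i\in B_c\}\cup\delta$, and $\gamma\models\{f(x_1,\dots,x_n)\}\cup\delta$ iff for all $(B_p,B_c)\in\mathcal{B}^c$: $\gamma\cup\{x_i:i\in B_p\}\models\{x_i:i\in B_c\}\cup\delta$, if and only if for every $k\in\{1,\dots,K\}$ and all $x_1,\dots,x_n\in V$: $f(x_1,\dots,x_n)\notin\mathcal{D}_p^k$ iff for all $(B_p,B_c)\in\mathcal{B}^p$: ($\{x_i:i\in B_p\}\subseteq\mathcal{D}_p^k\Rightarrow\{x_i:i\in B_c\}\cap\mathcal{D}_c^k\neq\emptyset$); and $f(x_1,\dots,x_n)\in\mathcal{D}_c^k$ iff for all $(B_p,B_c)\in\mathcal{B}^c$: ($\{x_i:i\in B_p\}\subseteq\mathcal{D}_p^k\Rightarrow\{x_i:i\in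 B_c\}\cap\mathcal{D}_c^k\neq\emptyset$).
   Context: A set of designated values is a subset $\mathcal{D}\subseteq V$ with $1\in\mathcal{D}$, $0\notin\mathcal{D}$. For such $\mathcal{D}_p,\mathcal{D}_c$, the mixed consequence truth-relation is $\gamma\models_{\mathcal{D}_p,\mathcal{D}_c}\delta$ iff ($\gamma\subseteq\mathcal{D}_p\Rightarrow\delta\cap\mathcal{D}_c\neq\emptyset$), for $\gamma,\delta\subseteq V$. An intersective mixed consequence truth-relation is a finite intersection of mixed ones; a list of mixed relations whose intersection is it is a representation, and a minimal representation is one with the least possible number of members. Empty conjunctions count as true. -}

module Defs where

open import Level using (Level; _⊔_)
open import Data.Nat using (ℕ; _≤_)
open import Data.Fin using (Fin; _≟_)
open import Data.Fin.Properties using (any?)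
open import Data.Fin.Subset using (Subset; _∈_; _∉_; _⊆_; _∪_; _∩_; ⁅_⁆; Nonempty)
open import Data.Fin.Subset.Properties using (_∈?_)
open import Data.Product using (∃; _×_; _,_)
open import Data.Vec using (Vec; lookup; tabulate)
open import Data.Vec.Properties using (lookup∘tabulate; []=⇒lookup; lookup⇒[]=)
open import Function using (_⇔_; mk⇔)
open import Relation.Binary using (Rel)
open import Relation.Binary.PropositionalEquality using (_≡_; sym; trans)
open import Relation.Nullary using (Dec; does)
open import Relation.Nullary.Decidable using (_×-dec_; dec-true; yes; no)
open import Relation.Unary using (Pred)

private
  variable
    m n K : ℕ
    ℓ ℓ′ : Level

-- The finite set V of truth values is Fin m, and its subsets are Subset m;
-- 𝟏 and 𝟎 are the distinguished truth values.

Designated : (𝟏 𝟎 : Fin m) → Subset m → Set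
Designated 𝟏 𝟎 D = 𝟏 ∈ D × 𝟎 ∉ D

Mixed : (Dp Dc : Subset m) → Rel (Subset m) _
Mixed Dp Dc γ δ = γ ⊆ Dp → Nonempty (δ ∩ Dc)

record IsRepresentation (𝟏 𝟎 : Fin m) (_⊨_ : Rel (Subset m) ℓ)
                        (Dp Dc : Fin K → Subset m) : Set ℓ where
  field
    designated-p : ∀ k → Designated 𝟏 𝟎 (Dp k)
    designated-c : ∀ k → Designated 𝟏 𝟎 (Dc k)
    intersection : ∀ γ δ → γ ⊨ δ ⇔ (∀ k → Mixed (Dp k) (Dc k) γ δ)

record IsMinimalRepresentation (𝟏 𝟎 : Fin m) (_⊨_ : Rel (Subset m) ℓ)
                               (Dp Dc : Fin K → Subset m) : Set ℓ where
  field
    isRepresentation : IsRepresentation 𝟏 𝟎 _⊨_ Dp Dc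
    minimal : ∀ {K′} (Dp′ Dc′ : Fin K′ → Subset m) →
              IsRepresentation 𝟏 𝟎 _⊨_ Dp′ Dc′ → K ≤ K′

-- values xs B = { xᵢ : i ∈ B }

occurs? : (xs : Vec (Fin m) n) (B : Subset n) (v : Fin m) →
          Dec (∃ λ i → i ∈ B × lookup xs i ≡ v)
occurs? xs B v = any? λ i → (i ∈? B) ×-dec (lookup xs i ≟ v)

values : Vec (Fin m) n → Subset n → Subset m
values xs B = tabulate λ v → does (occurs? xs B v)

∈-values : (xs : Vec (Fin m) n) (B : Subset n) (v : Fin m) →
           v ∈ values xs B ⇔ (∃ λ i → i ∈ B × lookup xs i ≡ v)
∈-values xs B v = mk⇔ to from
  where
  eq = lookup∘tabulate (λ w → does (occurs? xs B w)) v

  to : v ∈ values xs B → ∃ λ i → i ∈ B × lookup xs i ≡ v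
  to v∈ with occurs? xs B v | trans (sym eq) ([]=⇒lookup v∈)
  ... | yes p | _  = p
  ... | no  _ | ()

  from : (∃ λ i → i ∈ B × lookup xs i ≡ v) → v ∈ values xs B
  from p = lookup⇒[]= v _ (trans eq (dec-true (occurs? xs B v) p))

RuleSet : ℕ → (ℓ : Level) → Set _
RuleSet n ℓ = Pred (Subset n × Subset n) ℓ

record SatisfiesRule (_⊨_ : Rel (Subset m) ℓ) (f : Vec (Fin m) n → Fin m)
                     (𝓑p 𝓑c : RuleSet n ℓ′) : Set (ℓ ⊔ ℓ′) where
  field
    premise-rule : ∀ γ δ (xs : Vec (Fin m) n) →
      ((γ ∪ ⁅ f xs ⁆) ⊨ δ) ⇔
      (∀ Bp Bc → 𝓑p (Bp , Bc) → (γ ∪ values xs Bp) ⊨ (values xs Bc ∪ δ))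
    conclusion-rule : ∀ γ δ (xs : Vec (Fin m) n) →
      (γ ⊨ (⁅ f xs ⁆ ∪ δ)) ⇔
      (∀ Bp Bc → 𝓑c (Bp , Bc) → (γ ∪ values xs Bp) ⊨ (values xs Bc ∪ δ))

{-# OPTIONS --safe #-}
-- Any intersection of mixed relations respects a rule that each member respects.
-- Conversely, the sequent with premises Dp k and conclusions ∁ (Dc k) fails for
-- the k-th member, while a further member j that also refutes it would be
-- contained in the k-th one, making k redundant. Hence in a minimal
-- representation every other member holds in this context, and the rule
-- instantiated there speaks about the k-th member alone.
module Submission where

open import Data.Empty using (⊥-elim)
open import Data.Fin using (Fin; _≟_; punchIn; punchOut)
open import Data.Fin.Properties using (punchIn-punchOut)
open import Data.Fin.Subset using (Subset; _∈_; _∉_; _⊆_; _∪_; _∩_; ∁; ⊥; ⁅_⁆; Nonempty; Empty)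
open import Data.Fin.Subset.Properties
  using (_∈?_; nonempty?; x∈p∪q⁻; x∈p∪q⁺; x∈p∩q⁻; x∈p∩q⁺; x∈∁p⇒x∉p; x∉p⇒x∈∁p;
         ∉⊥; x∈⁅x⁆; x∈⁅y⁆⇒x≡y; ∪-identityˡ; ∪-identityʳ)
open import Data.Nat using (ℕ; suc)
open import Data.Nat.Properties using (1+n≰n)
open import Data.Product using (_×_; _,_; proj₁; proj₂)
open import Data.Sum using (_⊎_; inj₁; inj₂)
open import Data.Vec using (Vec)
open import Function using (_⇔_; mk⇔; _∘_; id; Equivalence)
open import Function.Construct.Composition using (_⇔-∘_)
open import Function.Construct.Symmetry using (⇔-sym)
open import Function.Related.Propositional using (≡⇒; equivalence)
open import Relation.Binary using (Rel)
open import Relation.Binary.PropositionalEquality using (_≢_; refl; sym; cong; subst)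
open import Relation.Nullary using (yes; no; ¬_; contradiction)
open import Relation.Nullary.Decidable using (decidable-stable)
open import Defs

open Equivalence using (to; from)

Mixed-antitone : ∀ {m} {Dp Dc Dp′ Dc′ : Subset m} → Dp ⊆ Dp′ → Dc′ ⊆ Dc →
  ∀ {γ δ} → Mixed Dp′ Dc′ γ δ → Mixed Dp Dc γ δ
Mixed-antitone {Dc′ = Dc′} Dp⊆ ⊆Dc {δ = δ} h γ⊆ with h (λ x∈ → Dp⊆ (γ⊆ x∈))
... | v , v∈ = v , x∈p∩q⁺ (proj₁ (x∈p∩q⁻ δ Dc′ v∈) , ⊆Dc (proj₂ (x∈p∩q⁻ δ Dc′ v∈)))

-- The context `γ`, `δ` either settles the sequent alone, because `γ` leaves `Dp` or `δ` meets `Dc`,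
-- or it contributes nothing and only `α` and `β` matter.
Mixed-∪ : ∀ {m} {Dp Dc : Subset m} (γ α β δ : Subset m) →
  Mixed Dp Dc (γ ∪ α) (β ∪ δ) ⇔ (γ ⊆ Dp → Empty (δ ∩ Dc) → Mixed Dp Dc α β)
Mixed-∪ {Dp = Dp} {Dc} γ α β δ = mk⇔ remove add
  where
  remove : Mixed Dp Dc (γ ∪ α) (β ∪ δ) → γ ⊆ Dp → Empty (δ ∩ Dc) → Mixed Dp Dc α β
  remove h γ⊆ δ∅ α⊆ with h (λ x∈ → [γ∪α]⊆ (x∈p∪q⁻ γ α x∈))
    where
    [γ∪α]⊆ : ∀ {x} → x ∈ γ ⊎ x ∈ α → x ∈ Dp
    [γ∪α]⊆ (inj₁ x∈γ) = γ⊆ x∈γ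
    [γ∪α]⊆ (inj₂ x∈α) = α⊆ x∈α
  ... | v , v∈ with x∈p∩q⁻ (β ∪ δ) Dc v∈
  ... | v∈βδ , v∈Dc with x∈p∪q⁻ β δ v∈βδ
  ... | inj₁ v∈β = v , x∈p∩q⁺ (v∈β , v∈Dc)
  ... | inj₂ v∈δ = contradiction (v , x∈p∩q⁺ (v∈δ , v∈Dc)) δ∅

  widen : ∀ {η} → η ⊆ β ∪ δ → Nonempty (η ∩ Dc) → Nonempty ((β ∪ δ) ∩ Dc)
  widen {η} η⊆ (v , v∈) with x∈p∩q⁻ η Dc v∈
  ... | v∈η , v∈Dc = v , x∈p∩q⁺ (η⊆ v∈η , v∈Dc)

  add : (γ ⊆ Dp → Empty (δ ∩ Dc) → Mixed Dp Dc α β) → Mixed Dp Dc (γ ∪ α) (β ∪ δ)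
  -- Deciding whether `δ` meets `Dc` chooses which half of `β ∪ δ` supplies the witness.
  add h ⊆Dp with nonempty? (δ ∩ Dc)
  ... | yes δ≠∅ = widen (λ x∈ → x∈p∪q⁺ (inj₂ x∈)) δ≠∅
  ... | no  δ∅  = widen (λ x∈ → x∈p∪q⁺ (inj₁ x∈))
                    (h (λ x∈ → ⊆Dp (x∈p∪q⁺ (inj₁ x∈))) δ∅ (λ x∈ → ⊆Dp (x∈p∪q⁺ (inj₂ x∈))))

-- Nothing lies in the empty conclusion set, so the sequent can hold only by failure of its premise.
Mixed-premise : ∀ {m} {Dp Dc : Subset m} (v : Fin m) → Mixed Dp Dc ⁅ v ⁆ ⊥ ⇔ v ∉ Dp
Mixed-premise {Dp = Dp} {Dc} v = mk⇔ outside λ v∉ ⊆Dp → contradiction (⊆Dp (x∈⁅x⁆ v)) v∉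
  where
  outside : Mixed Dp Dc ⁅ v ⁆ ⊥ → v ∉ Dp
  outside h v∈ with h (λ x∈ → subst (_∈ Dp) (sym (x∈⁅y⁆⇒x≡y v x∈)) v∈)
  ... | _ , w∈ = ∉⊥ (proj₁ (x∈p∩q⁻ ⊥ Dc w∈))

Mixed-conclusion : ∀ {m} {Dp Dc : Subset m} (v : Fin m) → Mixed Dp Dc ⊥ ⁅ v ⁆ ⇔ v ∈ Dc
Mixed-conclusion {Dp = Dp} {Dc} v = mk⇔ inside λ v∈ _ → v , x∈p∩q⁺ (x∈⁅x⁆ v , v∈)
  where
  inside : Mixed Dp Dc ⊥ ⁅ v ⁆ → v ∈ Dc
  inside h with h (λ x∈ → ⊥-elim (∉⊥ x∈))
  ... | _ , w∈ with x∈p∩q⁻ ⁅ v ⁆ Dc w∈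
  ... | w∈⁅v⁆ , w∈Dc = subst (_∈ Dc) (x∈⁅y⁆⇒x≡y v w∈⁅v⁆) w∈Dc

module _ {ℓ} {m K : ℕ} {𝟏 𝟎 : Fin m} {_⊨_ : Rel (Subset m) ℓ} where

  -- The inclusions make member `j` imply member `k`, and `j` survives the removal because `k ≢ j`;
  -- so the remaining members still determine the `k`-th.
  IsRepresentation-remove : ∀ {Dp Dc : Fin (suc K) → Subset m} →
    IsRepresentation 𝟏 𝟎 _⊨_ Dp Dc → ∀ {j k} → k ≢ j → Dp k ⊆ Dp j → Dc j ⊆ Dc k →
    IsRepresentation 𝟏 𝟎 _⊨_ (Dp ∘ punchIn k) (Dc ∘ punchIn k)
  IsRepresentation-remove {Dp} {Dc} rep {j} {k} k≢j Dp⊆ Dc⊆ = record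
    { designated-p = designated-p ∘ punchIn k
    ; designated-c = designated-c ∘ punchIn k
    ; intersection = λ γ δ → mk⇔
        (λ γ⊨δ → to (intersection γ δ) γ⊨δ ∘ punchIn k)
        (λ h → from (intersection γ δ) (restore h))
    }
    where
    open IsRepresentation rep

    retained : ∀ {γ δ} → (∀ i → Mixed (Dp (punchIn k i)) (Dc (punchIn k i)) γ δ) →
               ∀ {l} → k ≢ l → Mixed (Dp l) (Dc l) γ δ
    retained {γ} {δ} h k≢l =
      subst (λ l → Mixed (Dp l) (Dc l) γ δ) (punchIn-punchOut k≢l) (h (punchOut k≢l))

    restore : ∀ {γ δ} → (∀ i → Mixed (Dp (punchIn k i)) (Dc (punchIn k i)) γ δ) →
              ∀ l → Mixed (Dp l) (Dc l) γ δ
    restore {γ} {δ} h l with k ≟ l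
    ... | yes refl = Mixed-antitone Dp⊆ Dc⊆ {γ} {δ} (retained h k≢j)
    ... | no k≢l = retained h k≢l

irredundant : ∀ {ℓ m K} {𝟏 𝟎 : Fin m} {_⊨_ : Rel (Subset m) ℓ} {Dp Dc : Fin K → Subset m} →
  IsMinimalRepresentation 𝟏 𝟎 _⊨_ Dp Dc →
  ∀ {j k} → k ≢ j → Dp k ⊆ Dp j → ¬ (Dc j ⊆ Dc k)
-- `K` is a successor since `Fin K` is inhabited; removing `k` would leave a representation with one
-- member fewer.
irredundant {K = suc K} min k≢j Dp⊆ Dc⊆ =
  1+n≰n (minimal _ _ (IsRepresentation-remove isRepresentation k≢j Dp⊆ Dc⊆))
  where open IsMinimalRepresentation min

module _ {ℓ} {m K : ℕ} {𝟏 𝟎 : Fin m} {_⊨_ : Rel (Subset m) ℓ} {Dp Dc : Fin K → Subset m}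
         (min : IsMinimalRepresentation 𝟏 𝟎 _⊨_ Dp Dc) where
  open IsMinimalRepresentation min
  open IsRepresentation isRepresentation

  -- By `Mixed-∪`, a member constrains `α` and `β` only if the context passes its two guards. Member
  -- `k` passes both; for any other member, passing both would contradict `irredundant`.
  isolate : ∀ k α β → ((Dp k ∪ α) ⊨ (β ∪ ∁ (Dc k))) ⇔ Mixed (Dp k) (Dc k) α β
  isolate k α β = mk⇔
    (λ h → to (Mixed-∪ (Dp k) α β (∁ (Dc k))) (to (intersection _ _) h k) id
             λ (v , v∈) → let v∈∁ , v∈Dc = x∈p∩q⁻ (∁ (Dc k)) (Dc k) v∈
                          in x∈∁p⇒x∉p v∈∁ v∈Dc)
    (λ h → from (intersection _ _) λ j →
             from (Mixed-∪ (Dp k) α β (∁ (Dc k))) (member h j))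
    where
    member : Mixed (Dp k) (Dc k) α β → ∀ j →
             Dp k ⊆ Dp j → Empty (∁ (Dc k) ∩ Dc j) → Mixed (Dp j) (Dc j) α β
    member h j Dp⊆ ∅ with k ≟ j
    ... | yes refl = h
    ... | no  k≢j  = contradiction
      -- Since membership is decidable, disjointness of `∁ (Dc k)` and `Dc j` gives `Dc j ⊆ Dc k`.
      (λ {x} x∈ → decidable-stable (x ∈? Dc k) λ x∉ → ∅ (x , x∈p∩q⁺ (x∉p⇒x∈∁p x∉ , x∈)))
      (irredundant min k≢j Dp⊆)

  -- One form for both rules: `f xs` is placed in `α` for premises and in `β` for conclusions.
  -- Forward, the rule is instantiated at the context of `isolate`, which is the same on both sides.
  rule⇔memberwise : ∀ {ℓ′ n} (𝓑 : RuleSet n ℓ′) (σ : Subset n → Subset m) (α β : Subset m) →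
    (∀ γ δ → ((γ ∪ α) ⊨ (β ∪ δ)) ⇔
             (∀ Bp Bc → 𝓑 (Bp , Bc) → (γ ∪ σ Bp) ⊨ (σ Bc ∪ δ))) ⇔
    (∀ k → Mixed (Dp k) (Dc k) α β ⇔
           (∀ Bp Bc → 𝓑 (Bp , Bc) → Mixed (Dp k) (Dc k) (σ Bp) (σ Bc)))
  rule⇔memberwise 𝓑 σ α β = mk⇔
    (λ rule k → mk⇔
      (λ h Bp Bc b → to (isolate k _ _) (to (rule _ _) (from (isolate k α β) h) Bp Bc b))
      (λ h → to (isolate k α β) (from (rule _ _) λ Bp Bc b → from (isolate k _ _) (h Bp Bc b))))
    -- In any context both sides of the rule unfold to conditions under the same guards on `γ` and
    -- `δ`, so the equivalence for each member applies beneath them.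
    (λ memberwise γ δ → mk⇔
      (λ h Bp Bc b → from (in-context γ _ _ δ) λ k γ⊆ δ∅ →
        to (memberwise k) (to (in-context γ α β δ) h k γ⊆ δ∅) Bp Bc b)
      (λ h → from (in-context γ α β δ) λ k γ⊆ δ∅ →
        from (memberwise k) λ Bp Bc b → to (in-context γ _ _ δ) (h Bp Bc b) k γ⊆ δ∅))
    where
    in-context : ∀ γ α β δ → ((γ ∪ α) ⊨ (β ∪ δ)) ⇔
      (∀ k → γ ⊆ Dp k → Empty (δ ∩ Dc k) → Mixed (Dp k) (Dc k) α β)
    in-context γ α β δ = mk⇔
      (λ h k → to (Mixed-∪ γ α β δ) (to (intersection _ _) h k))
      (λ h → from (intersection _ _) λ k → from (Mixed-∪ γ α β δ) (h k))

theorem3p11 : ∀ {ℓ ℓ′} {m n K : ℕ} (𝟏 𝟎 : Fin m) → 𝟏 ≢ 𝟎 →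
    (_⊨_ : Rel (Subset m) ℓ) (Dp Dc : Fin K → Subset m) →
    IsMinimalRepresentation 𝟏 𝟎 _⊨_ Dp Dc →
    (f : Vec (Fin m) n → Fin m) (𝓑p 𝓑c : RuleSet n ℓ′) →
    SatisfiesRule _⊨_ f 𝓑p 𝓑c ⇔
    (∀ k (xs : Vec (Fin m) n) →
    (f xs ∉ Dp k ⇔
    (∀ Bp Bc → 𝓑p (Bp , Bc) →
    values xs Bp ⊆ Dp k → Nonempty (values xs Bc ∩ Dc k))) ×
    (f xs ∈ Dc k ⇔
    (∀ Bp Bc → 𝓑c (Bp , Bc) →
    values xs Bp ⊆ Dp k → Nonempty (values xs Bc ∩ Dc k))))
theorem3p11 _ _ _ _⊨_ Dp Dc min f 𝓑p 𝓑c = mk⇔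
  (λ rule k xs → let open SatisfiesRule rule in
      to (premise xs) (λ γ δ → premise-rule γ δ xs ⇔-∘ drop-⊥ˡ γ δ xs) k
        ⇔-∘ ⇔-sym (Mixed-premise (f xs))
    , to (conclusion xs) (λ γ δ → conclusion-rule γ δ xs ⇔-∘ drop-⊥ʳ γ δ xs) k
        ⇔-∘ ⇔-sym (Mixed-conclusion (f xs)))
  (λ memberwise → record
    { premise-rule = λ γ δ xs →
        from (premise xs) (λ k → proj₁ (memberwise k xs) ⇔-∘ Mixed-premise (f xs)) γ δ
          ⇔-∘ ⇔-sym (drop-⊥ˡ γ δ xs)
    ; conclusion-rule = λ γ δ xs →
        from (conclusion xs) (λ k → proj₂ (memberwise k xs) ⇔-∘ Mixed-conclusion (f xs)) γ δ
          ⇔-∘ ⇔-sym (drop-⊥ʳ γ δ xs)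
    })
  where
  premise    = λ xs → rule⇔memberwise min 𝓑p (values xs) ⁅ f xs ⁆ ⊥
  conclusion = λ xs → rule⇔memberwise min 𝓑c (values xs) ⊥ ⁅ f xs ⁆

  -- The shared form of the two rules leaves an empty set on the side where `f xs` is absent; this
  -- and `drop-⊥ʳ` absorb it.
  drop-⊥ˡ : ∀ γ δ xs → ((γ ∪ ⁅ f xs ⁆) ⊨ (⊥ ∪ δ)) ⇔ ((γ ∪ ⁅ f xs ⁆) ⊨ δ)
  drop-⊥ˡ γ δ xs = ≡⇒ {k = equivalence} (cong ((γ ∪ ⁅ f xs ⁆) ⊨_) (∪-identityˡ δ))

  drop-⊥ʳ : ∀ γ δ xs → ((γ ∪ ⊥) ⊨ (⁅ f xs ⁆ ∪ δ)) ⇔ (γ ⊨ (⁅ f xs ⁆ ∪ δ))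
  drop-⊥ʳ γ δ xs = ≡⇒ {k = equivalence} (cong (_⊨ (⁅ f xs ⁆ ∪ δ)) (∪-identityʳ γ))
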